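{- For every integer $d\ge 0$, $$H_d = \sum_{\delta\in \mathrm{PCom}_{\mathrm{dyad}}'(d)} E^+_\delta.$$
   Context: A composition of $n\ge 0$ is a finite tuple of positive integers with sum $n$; its length $\ell$ is the number of entries; the empty composition is the only composition of $0$. A polycomposition of $n$ is a sequence $\delta=(\alpha^{(1)},\alpha^{(2)},\dots)$ of (possibly empty) compositions with $\sum_{i\ge1} i|\alpha^{(i)}|=n$, where $|\alpha|$ is the sum of the entries of $\alpha$; write $\delta|^i=\alpha^{(i)}$. Each part $d$ of $\delta|^r$ gives a block $d^r$ of $\delta$ (degree $d$, multiplicity $r$; not exponentiation). $\mathrm{PCom}'_{\mathrm{dyad}}(d)$ is the set of polycompositions $\delta$ of $d$ such that all multiplicities are powers of $2$ (i.e. $\delta|^i$ is empty unless $i=2^k$ for some $k\ge 0$) and $\ell(\delta|^i)\le 1$ for all $i\ge1$. Let $x_{i,j}$ ($i,j\ge 1$) be indeterminates with $\deg x_{i,j}=i$; all series have rational coefficients. A monomial is square-free if every exponent is at most $1$. For $d\ge 0$, $H_d$ is the sum of all monomials of degree $d$ and $E^+_d$ is the sum of all square-free monomials of degree $d$. For a block $d^r$, $E^+_{d^r}$ is obtained from $E^+_d$ by replacing each $x_{i,j}$ by $x_{i,j}^r$, and $E^+_\delta=\prod E^+_{d^r}$ over all blocks $d^r$ of $\delta$ (counted with repetition; empty product $=1$). -}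

module Defs where

open import Data.Bool.Base using (if_then_else_)
open import Data.Fin.Base as Fin using (Fin; toℕ)
import Data.Fin.Properties as Fin
open import Data.List.Base as List
  using (List; []; _∷_; _++_; [_]; map; foldr; length; upTo; applyUpTo;
         allFin; tabulate; concatMap; cartesianProductWith; filter)
open import Data.List.Membership.Propositional using (_∈_)
open import Data.List.Membership.Propositional.Properties
  using (∈-cartesianProductWith⁺; ∈-cartesianProductWith⁻; ∈-applyUpTo⁺;
         ∈-filter⁺; ∈-filter⁻; ∈-tabulate⁺)
open import Data.List.Properties using (map-++; map-∘)
open import Data.List.Relation.Unary.All as All using (All; []; _∷_)
open import Data.List.Relation.Unary.AllPairs as AllPairs using ([]; _∷_)
open import Data.List.Relation.Unary.Any using (here; there)
open import Data.List.Relation.Unary.Unique.Propositional using (Unique)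
import Data.List.Relation.Unary.Unique.Propositional.Properties as Unique
open import Data.Nat.Base as ℕ
  using (ℕ; zero; suc; _+_; _*_; _∸_; _^_; _≤_; _<_; z≤n; s≤s; NonZero)
open import Data.Nat.DivMod using (_/_; 0/n≡0)
open import Data.Nat.Divisibility using (_∣_; _∣?_; _∣0)
open import Data.Nat.ListAction using (sum)
import Data.Nat.Properties as ℕ
open import Data.Product.Base using (_×_; _,_; ∃; proj₁; proj₂)
open import Data.Rational.Base as ℚ using (ℚ; 0ℚ; 1ℚ)
import Data.Rational.Properties as ℚ
open import Data.Vec.Base as Vec using (Vec; []; _∷_; lookup)
open import Function.Base using (_∘_; id)
open import Data.Product.Function.NonDependent.Propositional using (_×-⇔_)
open import Function.Bundles using (Func; _⇔_; mk⇔)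
open import Level using (0ℓ)
open import Relation.Binary.Bundles using (Setoid)
open import Relation.Binary.PropositionalEquality
  using (_≡_; _≢_; refl; sym; trans; cong; cong₂; subst; setoid; module ≡-Reasoning)
open import Relation.Nullary.Decidable
  using (Dec; yes; no; does; map′; _×-dec_; _→-dec_; ¬?; does-⇔; recompute)
open import Relation.Nullary.Negation using (¬_; contradiction)
open import Relation.Unary using (Decidable)

-- Row i, column j (counted from 0) holds the exponent of x_{i+1,j+1};
-- missing rows and entries stand for exponent 0.

Monomial : Set
Monomial = List (List ℕ)

entry : {A : Set} → A → List A → ℕ → A
entry z []       _       = z
entry z (x ∷ xs) zero    = x
entry z (x ∷ xs) (suc n) = entry z xs n

exponent : Monomial → ℕ → ℕ → ℕ
exponent m i j = entry 0 (entry [] m i) j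

infix 4 _≈_
_≈_ : Monomial → Monomial → Set
m ≈ m′ = ∀ i j → exponent m i j ≡ exponent m′ i j

monomialSetoid : Setoid 0ℓ 0ℓ
monomialSetoid = record
  { Carrier       = Monomial
  ; _≈_           = _≈_
  ; isEquivalence = record
    { refl  = λ _ _ → refl
    ; sym   = λ e i j → sym (e i j)
    ; trans = λ e f i j → trans (e i j) (f i j)
    }
  }

degreeFrom : ℕ → Monomial → ℕ
degreeFrom i []           = 0
degreeFrom i (row ∷ rows) = i * sum row + degreeFrom (suc i) rows

degree : Monomial → ℕ
degree = degreeFrom 1

splits : ℕ → List (ℕ × ℕ)
splits n = map (λ a → a , n ∸ a) (upTo (suc n))

_∷²_ : {A : Set} → A × A → List A × List A → List A × List A
(a , b) ∷² (as , bs) = a ∷ as , b ∷ bs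

splitsList : {A : Set} → (A → List (A × A)) → List A → List (List A × List A)
splitsList s []       = [ ([] , []) ]
splitsList s (x ∷ xs) = cartesianProductWith _∷²_ (s x) (splitsList s xs)

-- The pairs (a , b) with a · b = m, each once up to _≈_.

factorisations : Monomial → List (Monomial × Monomial)
factorisations = splitsList (splitsList splits)

Every : (ℕ → Set) → Monomial → Set
Every P m = ∀ i j → P (exponent m i j)

all⇒entry : {A : Set} {P : A → Set} {z : A} → P z →
            ∀ {xs} → All P xs → ∀ j → P (entry z xs j)
all⇒entry pz []       _       = pz
all⇒entry pz (p ∷ ps) zero    = p
all⇒entry pz (p ∷ ps) (suc j) = all⇒entry pz ps j

entry⇒all : {A : Set} {P : A → Set} {z : A} →
            ∀ xs → (∀ j → P (entry z xs j)) → All P xs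
entry⇒all []       h = []
entry⇒all (x ∷ xs) h = h 0 ∷ entry⇒all xs (h ∘ suc)

every? : {P : ℕ → Set} → Decidable P → P 0 → Decidable (Every P)
every? {P} P? p0 m = map′
  (λ ps i → all⇒entry p0 (all⇒entry {P = All P} [] ps i))
  (λ h → entry⇒all m (λ i → entry⇒all (entry [] m i) (h i)))
  (All.all? (All.all? P?) m)

Every-⇔ : ∀ (P : ℕ → Set) m m′ → m ≈ m′ → Every P m ⇔ Every P m′
Every-⇔ P m m′ e = mk⇔ (λ h i j → subst P (e i j) (h i j))
                  (λ h i j → subst P (sym (e i j)) (h i j))

SquareFree : Monomial → Set
SquareFree = Every (_≤ 1)

squareFree? : Decidable SquareFree
squareFree? = every? (ℕ._≤? 1) z≤n

IsOne : Monomial → Set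
IsOne = Every (_≡ 0)

isOne? : Decidable IsOne
isOne? = every? (ℕ._≟ 0) refl

IsPower : ℕ → Monomial → Set
IsPower r = Every (r ∣_)

isPower? : ∀ r → Decidable (IsPower r)
isPower? r = every? (r ∣?_) (r ∣0)

root : (r : ℕ) .{{_ : NonZero r}} → Monomial → Monomial
root r = map (map (_/ r))

entry-map : {A B : Set} (f : A → B) (z : A) → ∀ xs n →
            entry (f z) (map f xs) n ≡ f (entry z xs n)
entry-map f z []       n       = refl
entry-map f z (x ∷ xs) zero    = refl
entry-map f z (x ∷ xs) (suc n) = entry-map f z xs n

row-cong : ∀ xs ys → (∀ j → entry 0 xs j ≡ entry 0 ys j) → sum xs ≡ sum ys
row-cong []       []       e = refl
row-cong []       (y ∷ ys) e = cong₂ _+_ (e 0) (row-cong [] ys (e ∘ suc))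
row-cong (x ∷ xs) []       e = cong₂ _+_ (e 0) (row-cong xs [] (e ∘ suc))
row-cong (x ∷ xs) (y ∷ ys) e = cong₂ _+_ (e 0) (row-cong xs ys (e ∘ suc))

degreeFrom-cong : ∀ k m m′ → m ≈ m′ → degreeFrom k m ≡ degreeFrom k m′
degreeFrom-cong k []       []         e = refl
degreeFrom-cong k []       (r ∷ rs)   e = cong₂ _+_
  (trans (sym (ℕ.*-zeroʳ k)) (cong (k *_) (row-cong [] r (e 0))))
  (degreeFrom-cong (suc k) [] rs (e ∘ suc))
degreeFrom-cong k (r ∷ rs) []         e = cong₂ _+_
  (trans (cong (k *_) (row-cong r [] (e 0))) (ℕ.*-zeroʳ k))
  (degreeFrom-cong (suc k) rs [] (e ∘ suc))
degreeFrom-cong k (r ∷ rs) (r′ ∷ rs′) e = cong₂ _+_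
  (cong (k *_) (row-cong r r′ (e 0)))
  (degreeFrom-cong (suc k) rs rs′ (e ∘ suc))

exponent-root : ∀ r .{{_ : NonZero r}} m i j →
                exponent (root r m) i j ≡ exponent m i j / r
exponent-root r m i j = begin
  entry 0 (entry [] (root r m) i) j
    ≡⟨ cong (λ row → entry 0 row j) (entry-map (map (_/ r)) [] m i) ⟩
  entry 0 (map (_/ r) (entry [] m i)) j
    ≡⟨ cong (λ z → entry z (map (_/ r) (entry [] m i)) j) (sym (0/n≡0 r)) ⟩
  entry (0 / r) (map (_/ r) (entry [] m i)) j
    ≡⟨ entry-map (_/ r) 0 (entry [] m i) j ⟩
  exponent m i j / r ∎
  where open ≡-Reasoning

degree-cong : ∀ m m′ → m ≈ m′ → degree m ≡ degree m′
degree-cong = degreeFrom-cong 1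

root-cong : ∀ r .{{_ : NonZero r}} m m′ → m ≈ m′ → root r m ≈ root r m′
root-cong r m m′ e i j = begin
  exponent (root r m) i j  ≡⟨ exponent-root r m i j ⟩
  exponent m i j / r       ≡⟨ cong (_/ r) (e i j) ⟩
  exponent m′ i j / r      ≡⟨ exponent-root r m′ i j ⟨
  exponent (root r m′) i j ∎
  where open ≡-Reasoning

Series : Set
Series = Func monomialSetoid (setoid ℚ)

coeff : Series → Monomial → ℚ
coeff = Func.to

infix 4 _≋_
_≋_ : Series → Series → Set
f ≋ g = ∀ m → coeff f m ≡ coeff g m

sumℚ : List ℚ → ℚ
sumℚ = foldr ℚ._+_ 0ℚ

ind : {P : Set} → Dec P → ℚ
ind P? = if does P? then 1ℚ else 0ℚ

ind-cong : {P Q : Set} → P ⇔ Q → (P? : Dec P) (Q? : Dec Q) → ind P? ≡ ind Q?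
ind-cong P⇔Q P? Q? = cong (if_then 1ℚ else 0ℚ) (does-⇔ P⇔Q P? Q?)

≡-⇔ : {x y z : ℕ} → x ≡ y → (x ≡ z) ⇔ (y ≡ z)
≡-⇔ refl = mk⇔ id id

sumPairs : {A : Set} → (A → A → ℚ) → List (A × A) → ℚ
sumPairs F ps = sumℚ (map (λ (a , b) → F a b) ps)

sumℚ-++ : ∀ xs ys → sumℚ (xs ++ ys) ≡ sumℚ xs ℚ.+ sumℚ ys
sumℚ-++ []       ys = sym (ℚ.+-identityˡ _)
sumℚ-++ (x ∷ xs) ys = trans (cong (x ℚ.+_) (sumℚ-++ xs ys))
                            (sym (ℚ.+-assoc x (sumℚ xs) (sumℚ ys)))

sumPairs-ext : {A : Set} {F G : A → A → ℚ} → (∀ a b → F a b ≡ G a b) →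
               ∀ ps → sumPairs F ps ≡ sumPairs G ps
sumPairs-ext h []             = refl
sumPairs-ext h ((a , b) ∷ ps) = cong₂ ℚ._+_ (h a b) (sumPairs-ext h ps)

sumPairs-product : {A : Set} (F : List A → List A → ℚ) → ∀ ps qs →
  sumPairs F (cartesianProductWith _∷²_ ps qs) ≡
  sumPairs (λ a b → sumPairs (λ as bs → F (a ∷ as) (b ∷ bs)) qs) ps
sumPairs-product F []             qs = refl
sumPairs-product F ((a , b) ∷ ps) qs = begin
  sumℚ (map F′ (map ((a , b) ∷²_) qs ++ rest))
    ≡⟨ cong sumℚ (map-++ F′ (map ((a , b) ∷²_) qs) rest) ⟩
  sumℚ (map F′ (map ((a , b) ∷²_) qs) ++ map F′ rest)
    ≡⟨ sumℚ-++ (map F′ (map ((a , b) ∷²_) qs)) (map F′ rest) ⟩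
  sumℚ (map F′ (map ((a , b) ∷²_) qs)) ℚ.+ sumPairs F rest
    ≡⟨ cong₂ ℚ._+_ (cong sumℚ (sym (map-∘ qs))) (sumPairs-product F ps qs) ⟩
  _ ∎
  where
  open ≡-Reasoning
  F′ = λ (p : List _ × List _) → F (proj₁ p) (proj₂ p)
  rest = cartesianProductWith _∷²_ ps qs

module SplitsCong
  {A : Set} (_~_ : A → A → Set) (~-refl : ∀ {a} → a ~ a)
  (~-sym : ∀ {a b} → a ~ b → b ~ a)
  (z : A) (s : A → List (A × A)) (s-z : s z ≡ [ (z , z) ])
  (s-cong : ∀ F → (∀ a a′ b b′ → a ~ a′ → b ~ b′ → F a b ≡ F a′ b′) →
            ∀ x x′ → x ~ x′ → sumPairs F (s x) ≡ sumPairs F (s x′))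
  where

  _≈ᴸ_ : List A → List A → Set
  xs ≈ᴸ ys = ∀ i → entry z xs i ~ entry z ys i

  Respects : (List A → List A → ℚ) → Set
  Respects F = ∀ a a′ b b′ → a ≈ᴸ a′ → b ≈ᴸ b′ → F a b ≡ F a′ b′

  ∷-≈ᴸ : ∀ x y xs ys → x ~ y → xs ≈ᴸ ys → (x ∷ xs) ≈ᴸ (y ∷ ys)
  ∷-≈ᴸ x y xs ys e es zero    = e
  ∷-≈ᴸ x y xs ys e es (suc i) = es i

  heads-cong : ∀ F → Respects F → ∀ x y → x ~ y → ∀ ps →
    sumPairs (λ a b → sumPairs (λ as bs → F (a ∷ as) (b ∷ bs)) ps) (s x) ≡
    sumPairs (λ a b → sumPairs (λ as bs → F (a ∷ as) (b ∷ bs)) ps) (s y)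
  heads-cong F rF x y e ps = s-cong _
    (λ a a′ b b′ a~a′ b~b′ → sumPairs-ext
      (λ as bs → rF (a ∷ as) (a′ ∷ as) (b ∷ bs) (b′ ∷ bs)
        (∷-≈ᴸ a a′ as as a~a′ (λ _ → ~-refl))
        (∷-≈ᴸ b b′ bs bs b~b′ (λ _ → ~-refl))) ps)
    x y e

  z∷[] : (z ∷ []) ≈ᴸ []
  z∷[] zero    = ~-refl
  z∷[] (suc i) = ~-refl

  _▹_▹_ : (List A → List A → ℚ) → A → A → (List A → List A → ℚ)
  (F ▹ a ▹ b) as bs = F (a ∷ as) (b ∷ bs)

  tail-respects : ∀ F → Respects F → ∀ a b → Respects (F ▹ a ▹ b)
  tail-respects F rF a b as as′ bs bs′ e e′ =
    rF (a ∷ as) (a ∷ as′) (b ∷ bs) (b ∷ bs′)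
      (∷-≈ᴸ a a as as′ ~-refl e) (∷-≈ᴸ b b bs bs′ ~-refl e′)

  nil-cons : ∀ F → Respects F → ∀ x xs → [] ≈ᴸ (x ∷ xs) →
             sumPairs F (splitsList s []) ≡ sumPairs F (splitsList s (x ∷ xs))
  tails-cong : ∀ F → Respects F → ∀ xs ys → xs ≈ᴸ ys →
               sumPairs F (splitsList s xs) ≡ sumPairs F (splitsList s ys)

  nil-cons F rF x xs e = sym (begin
    sumPairs F (cartesianProductWith _∷²_ (s x) S)
      ≡⟨ sumPairs-product F (s x) S ⟩
    sumPairs (λ a b → sumPairs (F ▹ a ▹ b) S) (s x)
      ≡⟨ heads-cong F rF x z (~-sym (e 0)) S ⟩
    sumPairs (λ a b → sumPairs (F ▹ a ▹ b) S) (s z)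
      ≡⟨ cong (sumPairs (λ a b → sumPairs (F ▹ a ▹ b) S)) s-z ⟩
    sumPairs (F ▹ z ▹ z) S ℚ.+ 0ℚ
      ≡⟨ ℚ.+-identityʳ _ ⟩
    sumPairs (F ▹ z ▹ z) S
      ≡⟨ tails-cong (F ▹ z ▹ z) (tail-respects F rF z z) [] xs (e ∘ suc) ⟨
    F (z ∷ []) (z ∷ []) ℚ.+ 0ℚ
      ≡⟨ cong (ℚ._+ 0ℚ) (rF _ [] _ [] z∷[] z∷[]) ⟩
    F [] [] ℚ.+ 0ℚ ∎)
    where
    open ≡-Reasoning
    S = splitsList s xs

  tails-cong F rF []       []       e = refl
  tails-cong F rF []       (y ∷ ys) e = nil-cons F rF y ys e
  tails-cong F rF (x ∷ xs) []       e =
    sym (nil-cons F rF x xs (λ i → ~-sym (e i)))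
  tails-cong F rF (x ∷ xs) (y ∷ ys) e = begin
    sumPairs F (splitsList s (x ∷ xs))
      ≡⟨ sumPairs-product F (s x) (splitsList s xs) ⟩
    sumPairs (λ a b → sumPairs (F ▹ a ▹ b) (splitsList s xs)) (s x)
      ≡⟨ sumPairs-ext (λ a b → tails-cong (F ▹ a ▹ b)
           (tail-respects F rF a b) xs ys (e ∘ suc)) (s x) ⟩
    sumPairs (λ a b → sumPairs (F ▹ a ▹ b) (splitsList s ys)) (s x)
      ≡⟨ heads-cong F rF x y (e 0) (splitsList s ys) ⟩
    sumPairs (λ a b → sumPairs (F ▹ a ▹ b) (splitsList s ys)) (s y)
      ≡⟨ sumPairs-product F (s y) (splitsList s ys) ⟨
    sumPairs F (splitsList s (y ∷ ys)) ∎
    where open ≡-Reasoning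

splits-cong : (F : ℕ → ℕ → ℚ) →
  (∀ a a′ b b′ → a ≡ a′ → b ≡ b′ → F a b ≡ F a′ b′) →
  ∀ x x′ → x ≡ x′ → sumPairs F (splits x) ≡ sumPairs F (splits x′)
splits-cong F _ _ _ = cong (sumPairs F ∘ splits)

module Rows = SplitsCong _≡_ refl sym 0 splits refl splits-cong
module Matrices = SplitsCong Rows._≈ᴸ_ (λ _ → refl) (λ e i → sym (e i))
  [] (splitsList splits) refl Rows.tails-cong

0ˢ : Series
0ˢ = record { to = λ _ → 0ℚ ; cong = λ _ → refl }

1ˢ : Series
1ˢ = record
  { to   = λ m → ind (isOne? m)
  ; cong = λ {m} {m′} e → ind-cong (Every-⇔ (_≡ 0) m m′ e) (isOne? m) (isOne? m′)
  }

infixl 6 _+ˢ_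
_+ˢ_ : Series → Series → Series
f +ˢ g = record
  { to   = λ m → coeff f m ℚ.+ coeff g m
  ; cong = λ {m} {m′} e → cong₂ ℚ._+_ (Func.cong f {m} {m′} e) (Func.cong g {m} {m′} e)
  }

infixl 7 _*ˢ_
_*ˢ_ : Series → Series → Series
f *ˢ g = record
  { to   = λ m → sumℚ (map (λ (a , b) → coeff f a ℚ.* coeff g b) (factorisations m))
  ; cong = λ {m} {m′} → Matrices.tails-cong (λ a b → coeff f a ℚ.* coeff g b)
             (λ a a′ b b′ e e′ →
               cong₂ ℚ._*_ (Func.cong f {a} {a′} e) (Func.cong g {b} {b′} e′))
             m m′
  }

-- The substitution x_{i,j} ↦ x_{i,j}^r: a monomial has a nonzero
-- coefficient only if it is an r-th power, and its r-th root is unique.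

infix 8 _⟨x^_⟩
_⟨x^_⟩ : Series → (r : ℕ) .{{_ : NonZero r}} → Series
f ⟨x^ r ⟩ = record
  { to   = λ m → if does (isPower? r m) then coeff f (root r m) else 0ℚ
  ; cong = λ {m} {m′} e → cong₂ (λ b q → if b then q else 0ℚ)
      (does-⇔ (Every-⇔ (r ∣_) m m′ e) (isPower? r m) (isPower? r m′))
      (Func.cong f {root r m} {root r m′} (root-cong r m m′ e))
  }

∑ˢ : {A : Set} → List A → (A → Series) → Series
∑ˢ xs f = foldr _+ˢ_ 0ˢ (map f xs)

∏ˢ : {A : Set} → List A → (A → Series) → Series
∏ˢ xs f = foldr _*ˢ_ 1ˢ (map f xs)

infix 5 ∑ˢ ∏ˢ
syntax ∑ˢ xs (λ x → f) = ∑[ x ∈ xs ] f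
syntax ∏ˢ xs (λ x → f) = ∏[ x ∈ xs ] f

H : ℕ → Series
H d = record
  { to   = λ m → ind (degree m ℕ.≟ d)
  ; cong = λ {m} {m′} e → ind-cong (≡-⇔ (degree-cong m m′ e))
                                 (degree m ℕ.≟ d) (degree m′ ℕ.≟ d)
  }

E⁺ : ℕ → Series
E⁺ d = record
  { to   = λ m → ind ((degree m ℕ.≟ d) ×-dec squareFree? m)
  ; cong = λ {m} {m′} e → ind-cong
      (≡-⇔ (degree-cong m m′ e) ×-⇔ Every-⇔ (_≤ 1) m m′ e)
      ((degree m ℕ.≟ d) ×-dec squareFree? m)
      ((degree m′ ℕ.≟ d) ×-dec squareFree? m′)
  }

record Composition : Set where
  constructor composition
  field
    parts     : List ℕ
    .positive : All NonZero parts

open Composition public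

∣_∣ : Composition → ℕ
∣ α ∣ = sum (parts α)

ℓ : Composition → ℕ
ℓ α = length (parts α)

multiplicity : ∀ {n} → Fin n → ℕ
multiplicity i = suc (toℕ i)

-- In a polycomposition of n, α⁽ⁱ⁾ is empty for all i > n, so only
-- α⁽¹⁾ , … , α⁽ⁿ⁾ are recorded; δ ∣^ i is α⁽ᵏ⁾ for k = multiplicity i.

CompositionSeq : ℕ → Set
CompositionSeq n = Vec Composition n

infix 9 _∣^_
_∣^_ : ∀ {n} → CompositionSeq n → Fin n → Composition
δ ∣^ i = lookup δ i

weight : ∀ {n} → CompositionSeq n → ℕ
weight δ = sum (tabulate (λ i → multiplicity i * ∣ δ ∣^ i ∣))

IsPolycomposition : ∀ n → CompositionSeq n → Set
IsPolycomposition n δ = weight δ ≡ n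

IsPowerOf2 : ℕ → Set
IsPowerOf2 i = ∃ λ k → i ≡ 2 ^ k

IsDyadic : ∀ {n} → CompositionSeq n → Set
IsDyadic δ = ∀ i → ¬ IsPowerOf2 (multiplicity i) → parts (δ ∣^ i) ≡ []

IsPComDyad′ : ∀ n → CompositionSeq n → Set
IsPComDyad′ n δ = IsPolycomposition n δ × IsDyadic δ × (∀ i → ℓ (δ ∣^ i) ≤ 1)

record Block : Set where
  constructor block
  field
    blockDegree        : ℕ
    blockMultiplicity  : ℕ
    .{{nonZero}}       : NonZero blockMultiplicity

blocks : ∀ {n} → CompositionSeq n → List Block
blocks {n} δ = concatMap
  (λ i → map (λ d → block d (multiplicity i)) (parts (δ ∣^ i))) (allFin n)

E⁺-block : Block → Series
E⁺-block (block d r) = E⁺ d ⟨x^ r ⟩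

E⁺-seq : ∀ {n} → CompositionSeq n → Series
E⁺-seq δ = ∏[ b ∈ blocks δ ] E⁺-block b

isPowerOf2? : Decidable IsPowerOf2
isPowerOf2? i = map′
  (λ (k , _ , e) → k , e)
  (λ (k , e) → k , subst (k <_) (sym e) (k<2^k k) , e)
  (ℕ.anyUpTo? (λ k → i ℕ.≟ 2 ^ k) i)
  where
  k<2^k : ∀ k → k < 2 ^ k
  k<2^k zero    = s≤s z≤n
  k<2^k (suc k) = ℕ.≤-trans (ℕ.+-mono-≤ (ℕ.m^n>0 2 k) (k<2^k k))
    (ℕ.≤-reflexive (cong (2 ^ k +_) (sym (ℕ.+-identityʳ (2 ^ k)))))

isPComDyad′? : ∀ n → Decidable (IsPComDyad′ n)
isPComDyad′? n δ =
  (weight δ ℕ.≟ n) ×-dec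
  Fin.all? (λ i → ¬? (isPowerOf2? (multiplicity i)) →-dec isNil? (parts (δ ∣^ i))) ×-dec
  Fin.all? (λ i → ℓ (δ ∣^ i) ℕ.≤? 1)
  where
  isNil? : (xs : List ℕ) → Dec (xs ≡ [])
  isNil? []      = yes refl
  isNil? (_ ∷ _) = no λ ()

prepend : ℕ → Composition → Composition
prepend p (composition ps pos) = composition (suc p ∷ ps) (_ ∷ pos)

-- At most k parts, each at most n.

boundedCompositions : ℕ → ℕ → List Composition
boundedCompositions zero    n = [ composition [] [] ]
boundedCompositions (suc k) n = composition [] [] ∷
  cartesianProductWith prepend (upTo n) (boundedCompositions k n)

vectors : {A : Set} → List A → ∀ n → List (Vec A n)
vectors xs zero    = [ [] ]
vectors xs (suc n) = cartesianProductWith _∷_ xs (vectors xs n)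

candidates : ∀ n → List (CompositionSeq n)
candidates n = vectors (boundedCompositions n n) n

PComDyad′ : ∀ n → List (CompositionSeq n)
PComDyad′ n = filter (isPComDyad′? n) (candidates n)

boundedCompositions-complete : ∀ k n α → ∣ α ∣ ≤ k → ∣ α ∣ ≤ n →
                               α ∈ boundedCompositions k n
boundedCompositions-complete zero    n (composition [] _) _ _ = here refl
boundedCompositions-complete (suc k) n (composition [] _) _ _ = here refl
boundedCompositions-complete k n (composition (zero ∷ ps) pos) _ _
  with () ∷ _ ← recompute (All.all? ℕ.nonZero? (zero ∷ ps)) pos
boundedCompositions-complete (suc k) n (composition (suc p ∷ ps) pos) (s≤s ≤k) ≤n =
  there (∈-cartesianProductWith⁺ prepend
    (∈-applyUpTo⁺ id (ℕ.m+n≤o⇒m≤o (suc p) ≤n))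
    (boundedCompositions-complete k n (composition ps (All.tail pos))
      (ℕ.m+n≤o⇒n≤o p ≤k) (ℕ.m+n≤o⇒n≤o (suc p) ≤n)))

vectors-complete : {A : Set} (xs : List A) → ∀ {n} (v : Vec A n) →
                   (∀ i → lookup v i ∈ xs) → v ∈ vectors xs n
vectors-complete xs []      h = here refl
vectors-complete xs (x ∷ v) h = ∈-cartesianProductWith⁺ _∷_ (h Fin.zero)
  (vectors-complete xs v (h ∘ Fin.suc))

∈⇒≤sum : ∀ {x xs} → x ∈ xs → x ≤ sum xs
∈⇒≤sum {xs = y ∷ ys} (here refl) = ℕ.m≤m+n y (sum ys)
∈⇒≤sum {xs = y ∷ ys} (there x∈)  = ℕ.≤-trans (∈⇒≤sum x∈) (ℕ.m≤n+m (sum ys) y)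

component≤weight : ∀ {n} (δ : CompositionSeq n) i → ∣ δ ∣^ i ∣ ≤ weight δ
component≤weight δ i = ℕ.≤-trans (ℕ.m≤m+n _ _)
  (∈⇒≤sum (∈-tabulate⁺ {f = λ i → multiplicity i * ∣ δ ∣^ i ∣} i))

prepend-injective : ∀ {p q α β} → prepend p α ≡ prepend q β → p ≡ q × α ≡ β
prepend-injective {α = composition _ _} {composition _ _} refl = refl , refl

boundedCompositions-unique : ∀ k n → Unique (boundedCompositions k n)
boundedCompositions-unique zero    n = [] ∷ []
boundedCompositions-unique (suc k) n =
  All.tabulate (λ {α} α∈ e → nonempty (subst (_∈ _) (sym e) α∈)) ∷
  Unique.cartesianProductWith⁺ prepend prepend-injective
    (Unique.upTo⁺ n) (boundedCompositions-unique k n)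
  where
  nonempty : ¬ (composition [] [] ∈
                cartesianProductWith prepend (upTo n) (boundedCompositions k n))
  nonempty α∈ with ∈-cartesianProductWith⁻ prepend (upTo n) (boundedCompositions k n) α∈
  ... | _ , composition _ _ , _ , _ , ()

vectors-unique : {A : Set} {xs : List A} → Unique xs → ∀ n → Unique (vectors xs n)
vectors-unique u zero    = [] ∷ []
vectors-unique u (suc n) =
  Unique.cartesianProductWith⁺ _∷_ (λ { refl → refl , refl }) u (vectors-unique u n)

∈-PComDyad′ : ∀ n (δ : CompositionSeq n) → δ ∈ PComDyad′ n ⇔ IsPComDyad′ n δ
∈-PComDyad′ n δ = mk⇔
  (λ δ∈ → proj₂ (∈-filter⁻ (isPComDyad′? n) {xs = candidates n} δ∈))
  (λ p → ∈-filter⁺ (isPComDyad′? n)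
    (vectors-complete _ δ (λ i →
      let b = ℕ.≤-trans (component≤weight δ i) (ℕ.≤-reflexive (proj₁ p))
      in boundedCompositions-complete n n (δ ∣^ i) b b))
    p)

PComDyad′-unique : ∀ n → Unique (PComDyad′ n)
PComDyad′-unique n = Unique.filter⁺ (isPComDyad′? n)
  (vectors-unique (boundedCompositions-unique n n) n)

{-# OPTIONS --safe #-}

-- Let r = 2^k be the least multiplicity still to be treated, and let all
-- exponents of m be divisible by r.  In f · g with f = E⁺_d ⟨x^ r ⟩ and g a
-- product of blocks of higher multiplicity, exponents of f are 0 or r and those
-- of g are divisible by 2r, so only m = (m mod 2r) · (rest) contributes to the
-- coefficient at m.  Repeating this reads off the binary digits of the
-- exponents: exactly one δ, with |δ|^{2^k}| the degree of the k-th digit of m,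
-- has a nonzero coefficient at m, and that coefficient is 1.

module Submission where

open import Defs
open import Data.Bool.Base using (if_then_else_)
open import Data.Fin.Base as Fin using (Fin; toℕ)
open import Data.List.Base
  using (List; []; _∷_; _++_; map; tabulate; concat)
open import Data.List.Membership.Propositional using (_∈_)
open import Data.List.Membership.Propositional.Properties
  using (∈-cartesianProductWith⁺; ∈-cartesianProductWith⁻; ∈-map⁺; ∈-map⁻; ∈-upTo⁺; ∈-upTo⁻)
open import Data.List.Properties using (tabulate-cong; map-tabulate)
open import Data.List.Relation.Unary.All as All using (All; []; _∷_)
open import Data.List.Relation.Unary.AllPairs using ([]; _∷_)
open import Data.List.Relation.Unary.Any using (here; there)
open import Data.List.Relation.Unary.Unique.Propositional using (Unique)
import Data.List.Relation.Unary.Unique.Propositional.Properties as Unique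
open import Data.Nat.Base
  using (ℕ; zero; suc; _+_; _*_; _∸_; _^_; _≤_; _<_; z≤n; s≤s; NonZero)
open import Data.Nat.Divisibility
open import Data.Nat.DivMod
open import Data.Nat.ListAction using (sum)
import Data.Nat.Properties as ℕ
open import Algebra.Properties.CommutativeSemigroup ℕ.+-commutativeSemigroup
  using (interchange)
open import Data.Product.Base using (_×_; _,_; ∃; proj₁; proj₂)
open import Data.Rational.Base as ℚ using (ℚ; 0ℚ; 1ℚ)
import Data.Rational.Properties as ℚ
open import Data.Vec.Base using ([]; _∷_)
open import Function.Base using (_∘_; id)
open import Function.Bundles using (Func; Equivalence)
open import Relation.Binary.PropositionalEquality
open import Relation.Nullary.Decidable using (Dec; yes; no; does; _×-dec_; recompute)
open import Relation.Nullary.Negation using (¬_; contradiction)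

-- Finite rational sums with at most one nonzero term, and guarded coefficients.

sumℚ-zero : {A : Set} (F : A → ℚ) → ∀ xs → (∀ {x} → x ∈ xs → F x ≡ 0ℚ) →
            sumℚ (map F xs) ≡ 0ℚ
sumℚ-zero F []       F≡0 = refl
sumℚ-zero F (x ∷ xs) F≡0 =
  cong₂ ℚ._+_ (F≡0 (here refl)) (sumℚ-zero F xs (F≡0 ∘ there))

sumℚ-concentrated : {A : Set} (F : A → ℚ) → ∀ {x xs} → Unique xs → x ∈ xs →
                    (∀ {y} → y ∈ xs → F y ≢ 0ℚ → y ≡ x) → sumℚ (map F xs) ≡ F x
sumℚ-concentrated F {x} {_ ∷ xs} (x∉ ∷ _) (here refl) only = begin
  F x ℚ.+ sumℚ (map F xs) ≡⟨ cong (F x ℚ.+_) (sumℚ-zero F xs vanishes) ⟩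
  F x ℚ.+ 0ℚ              ≡⟨ ℚ.+-identityʳ (F x) ⟩
  F x                     ∎
  where
  open ≡-Reasoning
  vanishes : ∀ {y} → y ∈ xs → F y ≡ 0ℚ
  vanishes {y} y∈ with F y ℚ.≟ 0ℚ
  ... | yes Fy≡0 = Fy≡0
  ... | no  Fy≢0 = contradiction (sym (only (there y∈) Fy≢0)) (All.lookup x∉ y∈)
sumℚ-concentrated F {x} {y ∷ xs} (y∉ ∷ u) (there x∈) only with F y ℚ.≟ 0ℚ
... | no  Fy≢0 = contradiction (only (here refl) Fy≢0) (All.lookup y∉ x∈)
... | yes Fy≡0 = begin
  F y ℚ.+ sumℚ (map F xs)
    ≡⟨ cong₂ ℚ._+_ Fy≡0 (sumℚ-concentrated F u x∈ (only ∘ there)) ⟩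
  0ℚ ℚ.+ F x
    ≡⟨ ℚ.+-identityˡ (F x) ⟩
  F x ∎
  where open ≡-Reasoning

*-nonzeroˡ : ∀ {p q} → p ℚ.* q ≢ 0ℚ → p ≢ 0ℚ
*-nonzeroˡ {q = q} pq≢0 refl = pq≢0 (ℚ.*-zeroˡ q)

*-nonzeroʳ : ∀ {p q} → p ℚ.* q ≢ 0ℚ → q ≢ 0ℚ
*-nonzeroʳ {p} pq≢0 refl = pq≢0 (ℚ.*-zeroʳ p)

if-true : {P : Set} (P? : Dec P) {q : ℚ} → P → (if does P? then q else 0ℚ) ≡ q
if-true (yes _) _ = refl
if-true (no ¬p) p = contradiction p ¬p

if-false : {P : Set} (P? : Dec P) {q : ℚ} → ¬ P → (if does P? then q else 0ℚ) ≡ 0ℚ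
if-false (yes p) ¬p = contradiction p ¬p
if-false (no _)  _  = refl

if-nonzero : {P : Set} (P? : Dec P) {q : ℚ} →
             (if does P? then q else 0ℚ) ≢ 0ℚ → P × q ≢ 0ℚ
if-nonzero (yes p) ≢0 = p , ≢0
if-nonzero (no _)  ≢0 = contradiction refl ≢0

coeff-cong : ∀ f m m′ → m ≈ m′ → coeff f m ≡ coeff f m′
coeff-cong f m m′ = Func.cong f {m} {m′}

coeff-∑ˢ : {A : Set} (f : A → Series) → ∀ xs m →
           coeff (∑ˢ xs f) m ≡ sumℚ (map (λ x → coeff (f x) m) xs)
coeff-∑ˢ f []       m = refl
coeff-∑ˢ f (x ∷ xs) m = cong (coeff (f x) m ℚ.+_) (coeff-∑ˢ f xs m)

-- Factorisations of a monomial, and products with one contributing factorisation.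

splits-unique : ∀ n → Unique (splits n)
splits-unique n = Unique.map⁺ (cong proj₁) (Unique.upTo⁺ (suc n))

splitsList-unique : {A : Set} {s : A → List (A × A)} → (∀ x → Unique (s x)) →
                    ∀ xs → Unique (splitsList s xs)
splitsList-unique u []       = [] ∷ []
splitsList-unique u (x ∷ xs) =
  Unique.cartesianProductWith⁺ _∷²_ (λ { refl → refl , refl })
    (u x) (splitsList-unique u xs)

factorisations-unique : ∀ m → Unique (factorisations m)
factorisations-unique = splitsList-unique (splitsList-unique splits-unique)

∈-splits : ∀ {a b n} → a + b ≡ n → (a , b) ∈ splits n
∈-splits {a} {b} refl = subst (λ c → (a , c) ∈ splits (a + b)) (ℕ.m+n∸m≡n a b)
  (∈-map⁺ (λ a′ → a′ , a + b ∸ a′) (∈-upTo⁺ (s≤s (ℕ.m≤m+n a b))))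

splits-sum : ∀ {a b} n → (a , b) ∈ splits n → a + b ≡ n
splits-sum n ab∈ with ∈-map⁻ _ ab∈
... | a , a∈ , refl = ℕ.m+[n∸m]≡n (ℕ.≤-pred (∈-upTo⁻ a∈))

module _ {A : Set} (s : A → List (A × A)) (f g : A → A) where

  ∈-splitsList : (∀ x → (f x , g x) ∈ s x) →
                 ∀ xs → (map f xs , map g xs) ∈ splitsList s xs
  ∈-splitsList fg∈ []       = here refl
  ∈-splitsList fg∈ (x ∷ xs) =
    ∈-cartesianProductWith⁺ _∷²_ (fg∈ x) (∈-splitsList fg∈ xs)

  -- Phrased through `entry` with default `z` so that it can be used twice: once on the exponents of
  -- a row, and once on the rows of a monomial, where `R` becomes the pointwise relation between
  -- rows.
  splitsList-only : (z : A) (R : A → A → Set) →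
    (∀ x {a b} → (a , b) ∈ s x → R a b → (a , b) ≡ (f x , g x)) →
    ∀ xs {as bs} → (as , bs) ∈ splitsList s xs →
    (∀ i → R (entry z as i) (entry z bs i)) → (as , bs) ≡ (map f xs , map g xs)
  splitsList-only z R only []       (here refl) r = refl
  splitsList-only z R only (x ∷ xs) ∈s          r
    with ∈-cartesianProductWith⁻ _∷²_ (s x) (splitsList s xs) ∈s
  ... | _ , _ , ab∈ , asbs∈ , refl
    = cong₂ _∷²_ (only x ab∈ (r 0)) (splitsList-only z R only xs asbs∈ (r ∘ suc))

-- `R` is the constraint that the supports of `f` and `g` put on a pair of exponents. It lets the
-- pair be recovered from its sum, so all factorisations but one contribute 0; `φ` and `ψ` compute
-- the two exponents of that one.
coeff-*ˢ-concentrated : ∀ (f g : Series) (φ ψ : ℕ → ℕ) (R : ℕ → ℕ → Set) →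
  (∀ a b → R a b → (a , b) ≡ (φ (a + b) , ψ (a + b))) → (∀ n → φ n + ψ n ≡ n) →
  (∀ a b → coeff f a ≢ 0ℚ → coeff g b ≢ 0ℚ → ∀ i j → R (exponent a i j) (exponent b i j)) →
  ∀ m → coeff (f *ˢ g) m ≡ coeff f (map (map φ) m) ℚ.* coeff g (map (map ψ) m)
coeff-*ˢ-concentrated f g φ ψ R R⇒≡ φ+ψ supp m =
  sumℚ-concentrated (λ (a , b) → coeff f a ℚ.* coeff g b) (factorisations-unique m)
    (∈-splitsList _ _ _ (∈-splitsList _ φ ψ (λ n → ∈-splits (φ+ψ n))) m)
    (λ {(a , b)} ab∈ ab≢0 → splitsList-only _ (map φ) (map ψ) []
      (λ as bs → ∀ j → R (entry 0 as j) (entry 0 bs j))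
      (splitsList-only splits φ ψ 0 R only) m ab∈
      (supp a b (*-nonzeroˡ ab≢0) (*-nonzeroʳ {coeff f a} ab≢0)))
  where
  only : ∀ n {a b} → (a , b) ∈ splits n → R a b → (a , b) ≡ (φ n , ψ n)
  only n {a} {b} ab∈ r rewrite sym (splits-sum n ab∈) = R⇒≡ a b r

-- Exponents and degrees under entrywise operations.

exponent-map : ∀ (f : ℕ → ℕ) → f 0 ≡ 0 → ∀ m i j →
               exponent (map (map f) m) i j ≡ f (exponent m i j)
exponent-map f f0≡0 m i j = begin
  entry 0 (entry [] (map (map f) m) i) j
    ≡⟨ cong (λ row → entry 0 row j) (entry-map (map f) [] m i) ⟩
  entry 0 (map f (entry [] m i)) j
    ≡⟨ cong (λ z → entry z (map f (entry [] m i)) j) f0≡0 ⟨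
  entry (f 0) (map f (entry [] m i)) j
    ≡⟨ entry-map f 0 (entry [] m i) j ⟩
  f (exponent m i j) ∎
  where open ≡-Reasoning

entry≤sum : ∀ row j → entry 0 row j ≤ sum row
entry≤sum []        j       = z≤n
entry≤sum (x ∷ row) zero    = ℕ.m≤m+n x (sum row)
entry≤sum (x ∷ row) (suc j) = ℕ.≤-trans (entry≤sum row j) (ℕ.m≤n+m (sum row) x)

-- A nonzero `k` gives every row weight at least 1. With `k = 1` this bounds the exponents by the
-- degree, so the multiplicities up to the degree reach every binary digit of every exponent.
exponent≤degreeFrom : ∀ k .{{_ : NonZero k}} m i j → exponent m i j ≤ degreeFrom k m
exponent≤degreeFrom k []        i       j = z≤n
exponent≤degreeFrom k (row ∷ m) zero    j = ℕ.≤-trans (entry≤sum row j)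
  (ℕ.≤-trans (ℕ.m≤n*m (sum row) k) (ℕ.m≤m+n _ _))
exponent≤degreeFrom k (row ∷ m) (suc i) j =
  ℕ.≤-trans (exponent≤degreeFrom (suc k) m i j) (ℕ.m≤n+m _ (k * sum row))

sum-map-+ : ∀ (f g : ℕ → ℕ) → (∀ n → f n + g n ≡ n) → ∀ xs →
            sum (map f xs) + sum (map g xs) ≡ sum xs
sum-map-+ f g f+g []       = refl
sum-map-+ f g f+g (x ∷ xs) =
  trans (interchange (f x) _ (g x) _) (cong₂ _+_ (f+g x) (sum-map-+ f g f+g xs))

degreeFrom-+ : ∀ (f g : ℕ → ℕ) → (∀ n → f n + g n ≡ n) → ∀ k m →
               degreeFrom k (map (map f) m) + degreeFrom k (map (map g) m) ≡ degreeFrom k m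
degreeFrom-+ f g f+g k []        = refl
degreeFrom-+ f g f+g k (row ∷ m) =
  trans (interchange (k * sum (map f row)) _ (k * sum (map g row)) _)
    (cong₂ _+_
      (trans (sym (ℕ.*-distribˡ-+ k (sum (map f row)) _))
             (cong (k *_) (sum-map-+ f g f+g row)))
      (degreeFrom-+ f g f+g (suc k) m))

-- Splitting off the lowest binary digit of exponents divisible by `r`.

module _ (r : ℕ) .{{_ : NonZero r}} where

  sum-root : ∀ {xs} → All (r ∣_) xs → r * sum (map (_/ r) xs) ≡ sum xs
  sum-root []                  = ℕ.*-zeroʳ r
  sum-root {x ∷ xs} (r∣x ∷ r∣xs) = trans (ℕ.*-distribˡ-+ r (x / r) _)
    (cong₂ _+_ (m*[n/m]≡n r∣x) (sum-root r∣xs))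

  degreeFrom-root : ∀ k m → IsPower r m → r * degreeFrom k (root r m) ≡ degreeFrom k m
  degreeFrom-root k []        r∣m = ℕ.*-zeroʳ r
  degreeFrom-root k (row ∷ m) r∣m = begin
    r * (k * sum (map (_/ r) row) + degreeFrom (suc k) (root r m))
      ≡⟨ ℕ.*-distribˡ-+ r (k * sum (map (_/ r) row)) _ ⟩
    r * (k * sum (map (_/ r) row)) + r * degreeFrom (suc k) (root r m)
      ≡⟨ cong₂ _+_ (x∙yz≈y∙xz r k _) (degreeFrom-root (suc k) m (r∣m ∘ suc)) ⟩
    k * (r * sum (map (_/ r) row)) + degreeFrom (suc k) m
      ≡⟨ cong (λ t → k * t + degreeFrom (suc k) m) (sum-root (entry⇒all row (r∣m 0))) ⟩
    k * sum row + degreeFrom (suc k) m ∎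
    where
    open ≡-Reasoning
    open import Algebra.Properties.CommutativeSemigroup ℕ.*-commutativeSemigroup
      using (x∙yz≈y∙xz)

  E⁺-power-nonzero : ∀ d m → coeff (E⁺ d ⟨x^ r ⟩) m ≢ 0ℚ →
                     IsPower r m × degree (root r m) ≡ d × SquareFree (root r m)
  E⁺-power-nonzero d m ≢0 =
    let r∣m , q≢0 = if-nonzero (isPower? r m) ≢0
    in r∣m , proj₁ (if-nonzero ((degree (root r m) ℕ.≟ d) ×-dec squareFree? (root r m)) q≢0)

  E⁺-power-one : ∀ d m → IsPower r m → degree (root r m) ≡ d → SquareFree (root r m) →
                 coeff (E⁺ d ⟨x^ r ⟩) m ≡ 1ℚ
  E⁺-power-one d m r∣m deg sf = trans (if-true (isPower? r m) r∣m)
    (if-true ((degree (root r m) ℕ.≟ d) ×-dec squareFree? (root r m)) (deg , sf))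

  private instance
    2r≢0 : NonZero (2 * r)
    2r≢0 = ℕ.m*n≢0 2 r

  -- If `r` divides `e`, then `lowPart e` is `0` or `r`: it is `r` times the last binary digit of
  -- `e / r`, and `highPart e` is `e` with that digit cleared.
  lowPart highPart : ℕ → ℕ
  lowPart  e = e % (2 * r)
  highPart e = e / (2 * r) * (2 * r)

  low high : Monomial → Monomial
  low  = map (map lowPart)
  high = map (map highPart)

  exponent-low : ∀ m i j → exponent (low m) i j ≡ lowPart (exponent m i j)
  exponent-low = exponent-map lowPart (m*n%n≡0 0 (2 * r))

  exponent-high : ∀ m i j → exponent (high m) i j ≡ highPart (exponent m i j)
  exponent-high = exponent-map highPart (cong (_* (2 * r)) (0/n≡0 (2 * r)))

  lowPart+highPart : ∀ e → lowPart e + highPart e ≡ e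
  lowPart+highPart e = sym (m≡m%n+[m/n]*n e (2 * r))

  -- This is uniqueness of division with remainder by `2 * r`.
  lowPart-highPart-unique : ∀ a b → a < 2 * r × 2 * r ∣ b →
                            (a , b) ≡ (lowPart (a + b) , highPart (a + b))
  lowPart-highPart-unique a b (a<2r , divides-refl q) = cong₂ _,_ (sym low≡)
    (ℕ.+-cancelˡ-≡ a _ _ (sym (trans (cong (_+ highPart e) (sym low≡)) (lowPart+highPart e))))
    where
    e = a + q * (2 * r)
    low≡ : lowPart e ≡ a
    low≡ = trans ([m+kn]%n≡m%n a q (2 * r)) (m<n⇒m%n≡m a<2r)

  high-isPower : ∀ m → IsPower (2 * r) (high m)
  high-isPower m i j = subst (2 * r ∣_) (sym (exponent-high m i j))
    (n∣m*n (exponent m i j / (2 * r)))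

  exponent-high≤ : ∀ m i j → exponent (high m) i j ≤ exponent m i j
  exponent-high≤ m i j rewrite exponent-high m i j = m/n*n≤m _ (2 * r)

  low-isPower : ∀ m → IsPower r m → IsPower r (low m)
  low-isPower m r∣m i j rewrite exponent-low m i j = %-presˡ-∣ (r∣m i j) (n∣m*n 2 {r})

  -- A remainder below `2 * r` has quotient at most 1 by `r`, whether or not `r` divides it.
  low-squareFree : ∀ m → SquareFree (root r (low m))
  low-squareFree m i j rewrite exponent-root r (low m) i j | exponent-low m i j =
    ℕ.≤-pred (m<n*o⇒m/o<n (m%n<n _ (2 * r)))

  IsPower-low⇒IsPower : ∀ m → IsPower r (low m) → IsPower r m
  IsPower-low⇒IsPower m r∣low i j = subst (r ∣_) (lowPart+highPart (exponent m i j))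
    (∣m∣n⇒∣m+n (subst (r ∣_) (exponent-low m i j) (r∣low i j))
               (∣n⇒∣m*n (exponent m i j / (2 * r)) {2 * r} (n∣m*n 2)))

  low-isOne : ∀ m → IsPower (2 * r) m → IsOne (low m)
  low-isOne m 2r∣m i j rewrite exponent-low m i j = n∣m⇒m%n≡0 _ (2 * r) (2r∣m i j)

  high-≈ : ∀ m → IsOne (low m) → m ≈ high m
  high-≈ m low≡1 i j = begin
    e                      ≡⟨ lowPart+highPart e ⟨
    lowPart e + highPart e ≡⟨ cong (_+ highPart e) (trans (sym (exponent-low m i j)) (low≡1 i j)) ⟩
    highPart e             ≡⟨ exponent-high m i j ⟨
    exponent (high m) i j  ∎
    where
    open ≡-Reasoning
    e = exponent m i j

  degree-low-high : ∀ m → IsPower r (low m) →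
                    r * degree (root r (low m)) + degree (high m) ≡ degree m
  degree-low-high m r∣low = trans (cong (_+ degree (high m)) (degreeFrom-root 1 (low m) r∣low))
    (degreeFrom-+ lowPart highPart lowPart+highPart 1 m)

  coeff-block-*ˢ : ∀ d (g : Series) → (∀ m → coeff g m ≢ 0ℚ → IsPower (2 * r) m) →
    ∀ m → coeff (E⁺ d ⟨x^ r ⟩ *ˢ g) m ≡ coeff (E⁺ d ⟨x^ r ⟩) (low m) ℚ.* coeff g (high m)
  coeff-block-*ˢ d g supp =
    coeff-*ˢ-concentrated (E⁺ d ⟨x^ r ⟩) g lowPart highPart (λ a b → a < 2 * r × 2 * r ∣ b)
      lowPart-highPart-unique lowPart+highPart
      (λ a b a≢0 b≢0 i j → small a (E⁺-power-nonzero d a a≢0) i j , supp b b≢0 i j)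
    where
    open ℕ.≤-Reasoning
    small : ∀ a → IsPower r a × degree (root r a) ≡ d × SquareFree (root r a) →
            ∀ i j → exponent a i j < 2 * r
    -- Here `a` is the `r`-th power of a square-free monomial, so its exponents are at most `r`.
    small a (r∣a , _ , sf) i j = begin-strict
      exponent a i j            ≡⟨ m/n*n≡m (r∣a i j) ⟨
      exponent a i j / r * r    ≡⟨ cong (_* r) (exponent-root r a i j) ⟨
      exponent (root r a) i j * r ≤⟨ ℕ.*-monoˡ-≤ r (sf i j) ⟩
      1 * r                     <⟨ ℕ.*-monoˡ-< r {1} {2} ℕ.≤-refl ⟩
      2 * r                     ∎

  degree-root≡0⇒IsOne : ∀ m → IsPower r m → degree (root r m) ≡ 0 → IsOne m
  degree-root≡0⇒IsOne m r∣m deg≡0 i j = ℕ.n≤0⇒n≡0 (begin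
    exponent m i j          ≤⟨ exponent≤degreeFrom 1 m i j ⟩
    degree m                ≡⟨ degreeFrom-root 1 m r∣m ⟨
    r * degree (root r m)   ≡⟨ cong (r *_) deg≡0 ⟩
    r * 0                   ≡⟨ ℕ.*-zeroʳ r ⟩
    0                       ∎)
    where open ℕ.≤-Reasoning

  -- An absent block acts like a block of degree 0, which gives empty and one-part compositions the
  -- same coefficient formula. If `low m` is not 1, both sides vanish: the left because `g` lives on
  -- `2 * r`-th powers, the right because a nonzero factor of degree 0 would force `low m` to be 1.
  coeff-no-block : ∀ (g : Series) → (∀ m → coeff g m ≢ 0ℚ → IsPower (2 * r) m) →
    ∀ m → coeff g m ≡ coeff (E⁺ 0 ⟨x^ r ⟩) (low m) ℚ.* coeff g (high m)
  coeff-no-block g supp m with isOne? (low m)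
  ... | yes low≡1 = begin
    coeff g m                 ≡⟨ coeff-cong g m (high m) (high-≈ m low≡1) ⟩
    coeff g (high m)          ≡⟨ ℚ.*-identityˡ _ ⟨
    1ℚ ℚ.* coeff g (high m)   ≡⟨ cong (ℚ._* coeff g (high m)) (E⁺-power-one 0 (low m)
      (λ i j → subst (r ∣_) (sym (low≡1 i j)) (r ∣0))
      (degree-cong (root r (low m)) [] (root-cong r (low m) [] low≡1)) (low-squareFree m)) ⟨
    _                         ∎
    where open ≡-Reasoning
  ... | no low≢1 with coeff g m ℚ.≟ 0ℚ
  ...   | no  g≢0 = contradiction (low-isOne m (supp m g≢0)) low≢1
  ...   | yes g≡0 with coeff (E⁺ 0 ⟨x^ r ⟩) (low m) ℚ.* coeff g (high m) ℚ.≟ 0ℚ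
  ...     | yes Eg≡0 = trans g≡0 (sym Eg≡0)
  ...     | no  Eg≢0 =
    let r∣low , deg≡0 , _ = E⁺-power-nonzero 0 (low m) (*-nonzeroˡ Eg≢0)
    in contradiction (degree-root≡0⇒IsOne (low m) r∣low deg≡0) low≢1

-- Dyadic polycompositions by recursion on the multiplicity.

blocksFrom : ∀ {n} → ℕ → CompositionSeq n → List Block
blocksFrom o []      = []
blocksFrom o (α ∷ v) = map (λ d → block d (suc o)) (parts α) ++ blocksFrom (suc o) v

weightFrom : ∀ {n} → ℕ → CompositionSeq n → ℕ
weightFrom o []      = 0
weightFrom o (α ∷ v) = suc o * ∣ α ∣ + weightFrom (suc o) v

-- The offset `o` makes the induction go through: in the tail `toℕ` restarts at 0, and the lost unit
-- moves into `o`.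
blocks≡blocksFrom : ∀ {n} o (v : CompositionSeq n) →
  concat (tabulate (λ i → map (λ d → block d (suc (o + toℕ i))) (parts (v ∣^ i)))) ≡
  blocksFrom o v
blocks≡blocksFrom o []      = refl
blocks≡blocksFrom o (α ∷ v) = cong₂ _++_
  (cong (λ k → map (λ d → block d (suc k)) (parts α)) (ℕ.+-identityʳ o))
  (trans (cong concat (tabulate-cong (λ i →
            cong (λ k → map (λ d → block d (suc k)) (parts (v ∣^ i))) (ℕ.+-suc o (toℕ i)))))
         (blocks≡blocksFrom (suc o) v))

weight≡weightFrom : ∀ {n} o (v : CompositionSeq n) →
  sum (tabulate (λ i → suc (o + toℕ i) * ∣ v ∣^ i ∣)) ≡ weightFrom o v
weight≡weightFrom o []      = refl
weight≡weightFrom o (α ∷ v) = cong₂ _+_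
  (cong (λ k → suc k * ∣ α ∣) (ℕ.+-identityʳ o))
  (trans (cong sum (tabulate-cong (λ i → cong (λ k → suc k * ∣ v ∣^ i ∣) (ℕ.+-suc o (toℕ i)))))
         (weight≡weightFrom (suc o) v))

-- Entry i of v has multiplicity o + i + 1; p is the least admissible
-- multiplicity that is at least o + 1.

data Dyadic : ∀ {n} → ℕ → ℕ → CompositionSeq n → Set where
  []    : ∀ {o p} → Dyadic o p []
  power : ∀ {n o α} {v : CompositionSeq n} → ℓ α ≤ 1 →
          Dyadic (suc o) (2 * suc o) v → Dyadic o (suc o) (α ∷ v)
  gap   : ∀ {n o p α} {v : CompositionSeq n} → suc o ≢ p → parts α ≡ [] →
          Dyadic (suc o) p v → Dyadic o p (α ∷ v)

EverySeq : (ℕ → Composition → Set) → ∀ {n} → ℕ → CompositionSeq n → Set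
EverySeq P o v = ∀ i → P (suc (o + toℕ i)) (v ∣^ i)

EverySeq-head : ∀ P {n} o α (v : CompositionSeq n) → EverySeq P o (α ∷ v) → P (suc o) α
EverySeq-head P o α v h = subst (λ k → P (suc k) α) (ℕ.+-identityʳ o) (h Fin.zero)

EverySeq-tail : ∀ P {n} o α (v : CompositionSeq n) →
                EverySeq P o (α ∷ v) → EverySeq P (suc o) v
EverySeq-tail P o α v h i =
  subst (λ k → P (suc k) (v ∣^ i)) (ℕ.+-suc o (toℕ i)) (h (Fin.suc i))

EverySeq-∷ : ∀ P {n} o α (v : CompositionSeq n) →
             P (suc o) α → EverySeq P (suc o) v → EverySeq P o (α ∷ v)
EverySeq-∷ P o α v p h Fin.zero    = subst (λ k → P (suc k) α) (sym (ℕ.+-identityʳ o)) p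
EverySeq-∷ P o α v p h (Fin.suc i) =
  subst (λ k → P (suc k) (v ∣^ i)) (sym (ℕ.+-suc o (toℕ i))) (h i)

DyadicAt : ℕ → Composition → Set
DyadicAt r α = (¬ IsPowerOf2 r → parts α ≡ []) × ℓ α ≤ 1

-- If `r = 2 ^ j`, the first bound gives `j < k`, so `2 * r = 2 ^ suc j` is at most `2 ^ k`, against
-- the second bound.
between-powers : ∀ {r} k → r < 2 ^ k → 2 ^ k < 2 * r → ¬ IsPowerOf2 r
between-powers k r<2^k 2^k<2r (j , refl) = ℕ.<-irrefl refl (ℕ.<-≤-trans 2^k<2r
  (ℕ.^-monoʳ-≤ 2 {suc j} {k} (ℕ.≰⇒> (λ k≤j → ℕ.<⇒≱ r<2^k (ℕ.^-monoʳ-≤ 2 {k} {j} k≤j)))))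

next-power : ∀ r → suc (suc r) ≤ 2 * suc r × 2 * suc r < 2 * suc (suc r)
next-power r = subst (suc (suc r) ≤_) (ℕ.*-comm (suc r) 2) (ℕ.m<m*n (suc r) 2 (s≤s (s≤s z≤n)))
             , ℕ.*-monoʳ-< 2 {suc r} ℕ.≤-refl

-- The two bounds say that `2 ^ k` is the least power of 2 not below `suc o`. Hence `suc o` is
-- either that power or lies strictly between two consecutive powers, where the component must be
-- empty.
everySeq⇒dyadic : ∀ {n} o k (v : CompositionSeq n) → suc o ≤ 2 ^ k → 2 ^ k < 2 * suc o →
                  EverySeq DyadicAt o v → Dyadic o (2 ^ k) v
everySeq⇒dyadic o k []      _  _ h = []
everySeq⇒dyadic o k (α ∷ v) ≤p p< h with suc o ℕ.≟ 2 ^ k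
... | yes e = subst (λ p → Dyadic o p (α ∷ v)) e
  (power (proj₂ (EverySeq-head DyadicAt o α v h))
    (subst (λ p → Dyadic (suc o) (2 * p) v) (sym e)
      (everySeq⇒dyadic (suc o) (suc k) v
        (subst (λ p → suc (suc o) ≤ 2 * p) e (proj₁ (next-power o)))
        (subst (λ p → 2 * p < 2 * suc (suc o)) e (proj₂ (next-power o)))
        (EverySeq-tail DyadicAt o α v h))))
... | no ne = gap ne
  (proj₁ (EverySeq-head DyadicAt o α v h) (between-powers k (ℕ.≤∧≢⇒< ≤p ne) p<))
  (everySeq⇒dyadic (suc o) k v (ℕ.≤∧≢⇒< ≤p ne)
    (ℕ.<-trans p< (proj₂ (next-power o))) (EverySeq-tail DyadicAt o α v h))

dyadic⇒everySeq : ∀ {n o p} {v : CompositionSeq n} → IsPowerOf2 p →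
                  Dyadic o p v → EverySeq DyadicAt o v
dyadic⇒everySeq {o = o} {v = α ∷ v} pow@(k , e) (power ℓ≤1 D) = EverySeq-∷ DyadicAt o α v
  ((λ ¬pow → contradiction pow ¬pow) , ℓ≤1) (dyadic⇒everySeq (suc k , cong (2 *_) e) D)
dyadic⇒everySeq {o = o} {v = composition [] _ ∷ v} pow (gap _ refl D) =
  EverySeq-∷ DyadicAt o _ v ((λ _ → refl) , z≤n) (dyadic⇒everySeq pow D)

single : ℕ → Composition
single zero    = composition [] []
single (suc d) = composition (suc d ∷ []) (_ ∷ [])

∣single∣ : ∀ d → ∣ single d ∣ ≡ d
∣single∣ zero    = refl
∣single∣ (suc d) = ℕ.+-identityʳ (suc d)

ℓ-single : ∀ d → ℓ (single d) ≤ 1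
ℓ-single zero    = z≤n
ℓ-single (suc d) = s≤s z≤n

-- With at most one part the sum determines the composition; sum 0 leaves only the empty one,
-- because parts are positive.
single-∣∣ : ∀ α → ℓ α ≤ 1 → α ≡ single ∣ α ∣
single-∣∣ (composition [] _) _ = refl
single-∣∣ (composition (zero ∷ []) pos) _
  with () ∷ _ ← recompute (All.all? ℕ.nonZero? (zero ∷ [])) pos
single-∣∣ (composition (suc d ∷ []) _) _ rewrite ℕ.+-identityʳ d = refl
single-∣∣ (composition (_ ∷ _ ∷ _) _) (s≤s ())

-- Coefficients of products of blocks, one digit at a time.

∏blocks : ∀ {n} → ℕ → CompositionSeq n → Series
∏blocks o v = ∏ˢ (blocksFrom o v) E⁺-block

-- Proved together with `coeff-∏blocks-power` along the `Dyadic` derivation: the coefficient formula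
-- at `suc o` needs the support of the tail to lie in `2 * suc o`-th powers, and the support at
-- `suc o` is then read off from that formula.
∏blocks-support : ∀ {n o p} {v : CompositionSeq n} → Dyadic o p v →
                  ∀ m → coeff (∏blocks o v) m ≢ 0ℚ → IsPower p m

coeff-∏blocks-power : ∀ {n} o α {v : CompositionSeq n} → ℓ α ≤ 1 →
  Dyadic (suc o) (2 * suc o) v → ∀ m →
  coeff (∏blocks o (α ∷ v)) m ≡
  coeff (E⁺ ∣ α ∣ ⟨x^ suc o ⟩) (low (suc o) m) ℚ.* coeff (∏blocks (suc o) v) (high (suc o) m)

coeff-∏blocks-gap : ∀ {n} o α (v : CompositionSeq n) → parts α ≡ [] →
  ∀ m → coeff (∏blocks o (α ∷ v)) m ≡ coeff (∏blocks (suc o) v) m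

∏blocks-support [] m ≢0 i j = subst (_ ∣_) (sym (proj₁ (if-nonzero (isOne? m) ≢0) i j)) (_ ∣0)
∏blocks-support {o = o} {v = α ∷ _} (power ℓ≤1 D) m ≢0 = IsPower-low⇒IsPower (suc o) m
  (proj₁ (E⁺-power-nonzero (suc o) ∣ α ∣ (low (suc o) m)
    (*-nonzeroˡ (λ e → ≢0 (trans (coeff-∏blocks-power o α ℓ≤1 D m) e)))))
∏blocks-support {o = o} {v = α ∷ v} (gap _ nil D) m ≢0 =
  ∏blocks-support D m (λ e → ≢0 (trans (coeff-∏blocks-gap o α v nil m) e))

coeff-∏blocks-power o (composition [] _) {v} _ D m =
  coeff-no-block (suc o) (∏blocks (suc o) v) (∏blocks-support D) m
coeff-∏blocks-power o (composition (d ∷ []) _) {v} _ D m rewrite ℕ.+-identityʳ d =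
  coeff-block-*ˢ (suc o) d (∏blocks (suc o) v) (∏blocks-support D) m
coeff-∏blocks-power o (composition (_ ∷ _ ∷ _) _) (s≤s ())

coeff-∏blocks-gap o (composition [] _) v refl m = refl

-- Existence and uniqueness of the contributing polycomposition.

module _ {n o} α {v : CompositionSeq n} (ℓ≤1 : ℓ α ≤ 1)
         (D : Dyadic (suc o) (2 * suc o) v) m
         (≢0 : coeff (∏blocks o (α ∷ v)) m ≢ 0ℚ) where

  private
    product≢0 = λ e → ≢0 (trans (coeff-∏blocks-power o α ℓ≤1 D m) e)
    factor = E⁺-power-nonzero (suc o) ∣ α ∣ (low (suc o) m) (*-nonzeroˡ product≢0)

  nonzero⇒low-isPower : IsPower (suc o) (low (suc o) m)
  nonzero⇒low-isPower = proj₁ factor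

  digit-degree : degree (root (suc o) (low (suc o) m)) ≡ ∣ α ∣
  digit-degree = proj₁ (proj₂ factor)

  nonzero⇒high-nonzero : coeff (∏blocks (suc o) v) (high (suc o) m) ≢ 0ℚ
  nonzero⇒high-nonzero = *-nonzeroʳ {coeff (E⁺ ∣ α ∣ ⟨x^ suc o ⟩) (low (suc o) m)} product≢0

-- The degree of `m` is the sum of `r` times the degree of its digit at `r`, and a nonzero
-- coefficient forces each digit degree to equal the sum of the component at `r`.
nonzero⇒weight : ∀ {n o p} {v : CompositionSeq n} → Dyadic o p v →
                 ∀ m → coeff (∏blocks o v) m ≢ 0ℚ → weightFrom o v ≡ degree m
nonzero⇒weight [] m ≢0 = sym (degree-cong m [] (proj₁ (if-nonzero (isOne? m) ≢0)))
nonzero⇒weight {o = o} {v = α ∷ v} (power ℓ≤1 D) m ≢0 = trans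
  (cong₂ _+_ (cong (suc o *_) (sym (digit-degree α ℓ≤1 D m ≢0)))
             (nonzero⇒weight D (high (suc o) m) (nonzero⇒high-nonzero α ℓ≤1 D m ≢0)))
  (degree-low-high (suc o) m (nonzero⇒low-isPower α ℓ≤1 D m ≢0))
nonzero⇒weight {o = o} {v = composition [] _ ∷ v} (gap _ refl D) m ≢0 =
  trans (cong (_+ weightFrom (suc o) v) (ℕ.*-zeroʳ (suc o))) (nonzero⇒weight D m ≢0)

-- By `digit-degree`, the sum of each component at a power of 2 is a quantity depending on `m`
-- alone, and a component of length at most 1 is determined by its sum.
nonzero-unique : ∀ {n o p} {v w : CompositionSeq n} → Dyadic o p v → Dyadic o p w →
  ∀ m → coeff (∏blocks o v) m ≢ 0ℚ → coeff (∏blocks o w) m ≢ 0ℚ → v ≡ w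
nonzero-unique [] [] m _ _ = refl
nonzero-unique {o = o} {v = α ∷ _} {β ∷ _} (power ℓα D) (power ℓβ D′) m ≢0 ≢0′ = cong₂ _∷_
  (trans (single-∣∣ α ℓα) (trans
    (cong single (trans (sym (digit-degree α ℓα D m ≢0)) (digit-degree β ℓβ D′ m ≢0′)))
    (sym (single-∣∣ β ℓβ))))
  (nonzero-unique D D′ (high (suc o) m) (nonzero⇒high-nonzero α ℓα D m ≢0) (nonzero⇒high-nonzero β ℓβ D′ m ≢0′))
-- Both derivations share `o` and `p`, and whether `suc o` equals `p` decides between `power` and
-- `gap`.
nonzero-unique (power _ _) (gap ne _ _) m _ _ = contradiction refl ne
nonzero-unique (gap ne _ _) (power _ _) m _ _ = contradiction refl ne
nonzero-unique {v = composition [] _ ∷ _} {composition [] _ ∷ _}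
  (gap _ refl D) (gap _ refl D′) m ≢0 ≢0′ = cong (_ ∷_) (nonzero-unique D D′ m ≢0 ≢0′)

-- The bound `o + n` is the largest multiplicity still available. Once none is left, every exponent
-- is at most `o` and divisible by `p > o`, hence 0, and the empty product has coefficient 1.
coeff-one : ∀ n o p m → suc o ≤ p → IsPower p m → (∀ i j → exponent m i j ≤ o + n) →
            ∃ λ (v : CompositionSeq n) → Dyadic o p v × coeff (∏blocks o v) m ≡ 1ℚ
coeff-one zero o p m o<p p∣m e≤ = [] , [] , if-true (isOne? m) isOne
  where
  isOne : IsOne m
  isOne i j with exponent m i j | p∣m i j | e≤ i j
  ... | zero  | _   | _     = refl
  ... | suc e | p∣e | e≤o = contradiction (ℕ.≤-trans o<p (∣⇒≤ p∣e))
                              (ℕ.≤⇒≯ (subst (suc e ≤_) (ℕ.+-identityʳ o) e≤o))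
coeff-one (suc n) o p m o<p p∣m e≤ with suc o ℕ.≟ p
... | yes refl =
  -- The only possible choice: `digit-degree` forces the component here to have sum `d`.
  let d = degree (root (suc o) (low (suc o) m))
      v , D , ≡1 = coeff-one n (suc o) (2 * suc o) (high (suc o) m) (proj₁ (next-power o))
        (high-isPower (suc o) m)
        (λ i j → subst (exponent (high (suc o) m) i j ≤_) (ℕ.+-suc o n)
          (ℕ.≤-trans (exponent-high≤ (suc o) m i j) (e≤ i j)))
  in single d ∷ v , power (ℓ-single d) D ,
     trans (coeff-∏blocks-power o (single d) (ℓ-single d) D m)
       (cong₂ ℚ._*_ (E⁺-power-one (suc o) ∣ single d ∣ (low (suc o) m)
         (low-isPower (suc o) m p∣m) (sym (∣single∣ d)) (low-squareFree (suc o) m)) ≡1)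
... | no ne =
  let v , D , ≡1 = coeff-one n (suc o) p m (ℕ.≤∧≢⇒< o<p ne) p∣m
        (λ i j → subst (exponent m i j ≤_) (ℕ.+-suc o n) (e≤ i j))
  in composition [] [] ∷ v , gap ne refl D , ≡1

-- Summation over all dyadic polycompositions.

coeff-E⁺-seq : ∀ {n} (δ : CompositionSeq n) m → coeff (E⁺-seq δ) m ≡ coeff (∏blocks 0 δ) m
coeff-E⁺-seq {n} δ m = cong (λ bs → coeff (∏ˢ bs E⁺-block) m)
  (trans (cong concat (map-tabulate {n = n} id blocksAt)) (blocks≡blocksFrom 0 δ))
  where
  blocksAt : Fin n → List Block
  blocksAt i = map (λ d → block d (multiplicity i)) (parts (δ ∣^ i))

∈-PComDyad′⇒dyadic : ∀ {d} {δ : CompositionSeq d} → δ ∈ PComDyad′ d →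
                     weightFrom 0 δ ≡ d × Dyadic 0 1 δ
∈-PComDyad′⇒dyadic {d} {δ} δ∈ =
  let w , dy , ℓ≤1 = Equivalence.to (∈-PComDyad′ d δ) δ∈
  in trans (sym (weight≡weightFrom 0 δ)) w
   , everySeq⇒dyadic 0 0 δ (s≤s z≤n) (s≤s (s≤s z≤n)) (λ i → dy i , ℓ≤1 i)

dyadic⇒∈-PComDyad′ : ∀ {d} {δ : CompositionSeq d} → weightFrom 0 δ ≡ d → Dyadic 0 1 δ →
                     δ ∈ PComDyad′ d
dyadic⇒∈-PComDyad′ {d} {δ} w D =
  let h = dyadic⇒everySeq (0 , refl) D
  in Equivalence.from (∈-PComDyad′ d δ)
       (trans (weight≡weightFrom 0 δ) w , proj₁ ∘ h , proj₂ ∘ h)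

proposition28 : ∀ (d : ℕ) → H d ≋ ∑[ δ ∈ PComDyad′ d ] E⁺-seq δ
proposition28 d m = sym (trans (coeff-∑ˢ E⁺-seq (PComDyad′ d) m) sum≡)
  where
  nonzero : ∀ (δ : CompositionSeq d) → coeff (E⁺-seq δ) m ≢ 0ℚ → coeff (∏blocks 0 δ) m ≢ 0ℚ
  nonzero δ ≢0 e = ≢0 (trans (coeff-E⁺-seq δ m) e)

  sum≡ : sumℚ (map (λ δ → coeff (E⁺-seq δ) m) (PComDyad′ d)) ≡ coeff (H d) m
  sum≡ with degree m ℕ.≟ d
  ... | no deg≢d =
    trans (sumℚ-zero _ (PComDyad′ d) vanishes) (sym (if-false (degree m ℕ.≟ d) deg≢d))
    where
    vanishes : ∀ {δ} → δ ∈ PComDyad′ d → coeff (E⁺-seq δ) m ≡ 0ℚ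
    vanishes {δ} δ∈ with coeff (E⁺-seq δ) m ℚ.≟ 0ℚ
    ... | yes ≡0 = ≡0
    -- A nonzero term would make the weight `d` equal to the degree of `m`.
    ... | no ≢0 = let w , D = ∈-PComDyad′⇒dyadic δ∈ in
      contradiction (trans (sym (nonzero⇒weight D m (nonzero δ ≢0))) w) deg≢d
  ... | yes refl =
    -- The recursion starts at multiplicity 1, which divides every exponent; since no exponent
    -- exceeds the degree `d`, the multiplicities `1` to `d` suffice.
    let δ , D , ≡1 = coeff-one d 0 1 m (s≤s z≤n) (λ i j → 1∣ exponent m i j)
                       (exponent≤degreeFrom 1 m)
        ≢0 : coeff (∏blocks 0 δ) m ≢ 0ℚ
        ≢0 e = contradiction (trans (sym ≡1) e) (λ ())
    in trans
      (sumℚ-concentrated (λ δ → coeff (E⁺-seq δ) m) (PComDyad′-unique d)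
        -- `coeff-one` does not record the weight of `δ`; it follows from the coefficient being
        -- nonzero.
        (dyadic⇒∈-PComDyad′ (nonzero⇒weight D m ≢0) D)
        (λ {ε} ε∈ ε≢0 → nonzero-unique (proj₂ (∈-PComDyad′⇒dyadic ε∈)) D m (nonzero ε ε≢0) ≢0))
      (trans (trans (coeff-E⁺-seq δ m) ≡1) (sym (if-true (d ℕ.≟ d) refl)))
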